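{- For every integer $c\ge1$ there is a finite connected graph with minimum degree $c$ that is strongly non-stackable.
   Context: Cup stacking on a finite connected graph: initially one cup on every vertex; a move takes all $r\ge1$ cups from a vertex $x$ onto a vertex $y\neq x$ that already carries at least one cup and satisfies $d(x,y)=r$ (shortest-path distance). A graph is $t$-stackable if some sequence of moves ends with all cups on $t$; it is strongly non-stackable if it is not $t$-stackable for any vertex $t$. -}

module Defs where

open import Data.Nat using (ℕ; zero; suc; _+_; _<_; _≥_; _≤_)
open import Data.Fin using (Fin)
open import Data.Bool using (Bool; true; false; if_then_else_)
open import Data.List using (List; map; allFin)
open import Data.Nat.ListAction using (sum)
open import Data.Product using (Σ; _×_; ∃; _,_)
open import Relation.Binary.PropositionalEquality using (_≡_; _≢_)
open import Relation.Nullary using (¬_)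

record Graph : Set where
  field
    n     : ℕ
    adj   : Fin n → Fin n → Bool
    sym   : ∀ x y → adj x y ≡ adj y x
    irrefl : ∀ x → adj x x ≡ false
open Graph public

data Walk (G : Graph) : Fin (n G) → Fin (n G) → ℕ → Set where
  here : ∀ {x} → Walk G x x 0
  step : ∀ {x y z k} → adj G x y ≡ true → Walk G y z k → Walk G x z (suc k)

Connected : Graph → Set
Connected G = ∀ x y → ∃ λ k → Walk G x y k

Dist : (G : Graph) → Fin (n G) → Fin (n G) → ℕ → Set
Dist G x y r = Walk G x y r × (∀ k → k < r → ¬ Walk G x y k)

degree : (G : Graph) → Fin (n G) → ℕ
degree G x = sum (map (λ y → if adj G x y then 1 else 0) (allFin (n G)))

MinDegree : Graph → ℕ → Set
MinDegree G c = (∀ x → degree G x ≥ c) × (∃ λ x → degree G x ≡ c)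

-- Configuration: number of cups on each vertex.
Config : Graph → Set
Config G = Fin (n G) → ℕ

initial : (G : Graph) → Config G
initial G _ = 1

record Move (G : Graph) (f g : Config G) : Set where
  field
    x y      : Fin (n G)
    x≢y      : x ≢ y
    fx≥1     : f x ≥ 1
    fy≥1     : f y ≥ 1
    dist     : Dist G x y (f x)
    g-x      : g x ≡ 0
    g-y      : g y ≡ f y + f x
    g-other  : ∀ z → z ≢ x → z ≢ y → g z ≡ f z

data Reachable (G : Graph) : Config G → Config G → Set where
  done : ∀ {f} → Reachable G f f
  move : ∀ {f g h} → Move G f g → Reachable G g h → Reachable G f h

AllOn : (G : Graph) → Fin (n G) → Config G → Set
AllOn G t g = (g t ≡ n G) × (∀ z → z ≢ t → g z ≡ 0)

Stackable : (G : Graph) → Fin (n G) → Set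
Stackable G t = ∃ λ g → Reachable G (initial G) g × AllOn G t g

StronglyNonStackable : Graph → Set
StronglyNonStackable G = ∀ t → ¬ Stackable G t

{-# OPTIONS --safe #-}

-- Blow up the path P₄ to leaf₀ – core₀ – core₁ – leaf₁ with c vertices in each core class and
-- m = 4c + 1 in each leaf class.  The diameter is 3, so a stack of four or more cups never moves.
-- Given a target t, let J be the leaf class on the other side: no vertex of J can send its
-- single cup directly to t, and the 2c core vertices are too few to help all of J.  This is
-- made precise by a weight on stacks whose total never decreases along moves that leave t
-- nonempty, but which starts above its final value.
module Submission where

open import Defs
open import Data.Bool using (Bool; true; false; not; _xor_; if_then_else_)
open import Data.Bool.Properties using (xor-comm)
open import Data.Empty using (⊥-elim)
open import Data.Fin using (Fin; zero; suc)
open import Data.Fin.Properties using (_≟_; suc-injective; nonZeroIndex)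
open import Data.List using (List; []; _++_; length; lookup; map; replicate; tabulate)
open import Data.List.Properties using (map-tabulate; tabulate-lookup)
open import Data.List.Membership.Propositional using (_∈_)
open import Data.List.Membership.Propositional.Properties using (∈-++⁺ˡ; ∈-++⁺ʳ)
open import Data.List.Relation.Unary.Any using (here; index)
open import Data.List.Relation.Unary.Any.Properties using (lookup-index)
open import Data.Nat using (ℕ; zero; suc; _+_; _*_; _≤_; _<_; _≥_; z≤n; s≤s; ≢-nonZero⁻¹)
open import Data.Nat.ListAction using (sum)
open import Data.Nat.Properties hiding (_≟_; suc-injective)
open import Data.Nat.Tactic.RingSolver using (solve-∀)
open import Data.Product using (Σ; ∃; ∃₂; _×_; _,_; proj₁; proj₂)
open import Data.Sum using (_⊎_; inj₁; inj₂)
open import Function using (_∘_; id)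
open import Relation.Binary.PropositionalEquality using (_≡_; _≢_; refl; trans; cong; cong₂; subst) renaming (sym to ≡-sym)
open import Relation.Nullary using (¬_; yes; no)

-- Sums over `Fin n` and over lists of repeated entries.

∑ : ∀ {n} → (Fin n → ℕ) → ℕ
∑ F = sum (tabulate F)

∑-mono : ∀ {n} {F G : Fin n → ℕ} → (∀ z → F z ≤ G z) → ∑ F ≤ ∑ G
∑-mono {zero}  F≤G = z≤n
∑-mono {suc n} F≤G = +-mono-≤ (F≤G zero) (∑-mono (F≤G ∘ suc))

swap-+ : ∀ a b c → a + b + c ≡ b + (a + c)
swap-+ = solve-∀

-- The slacks `a` and `b` make room for a second exceptional index: `∑-mono-off₂` moves its terms
-- into them once the recursion reaches it.
∑-mono-off₁ : ∀ {n} {F G : Fin n → ℕ} {a b} x → (∀ z → z ≢ x → F z ≤ G z) →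
              F x + a ≤ G x + b → ∑ F + a ≤ ∑ G + b
∑-mono-off₁ {suc n} {F} {G} {a} {b} zero off at = begin
  F zero + ∑ (F ∘ suc) + a    ≡⟨ swap-+ (F zero) _ a ⟩
  ∑ (F ∘ suc) + (F zero + a)  ≤⟨ +-mono-≤ (∑-mono (λ z → off (suc z) (λ ()))) at ⟩
  ∑ (G ∘ suc) + (G zero + b)  ≡⟨ swap-+ (G zero) _ b ⟨
  G zero + ∑ (G ∘ suc) + b    ∎
  where open ≤-Reasoning
∑-mono-off₁ {suc n} {F} {G} {a} {b} (suc x) off at = begin
  F zero + ∑ (F ∘ suc) + a    ≡⟨ +-assoc (F zero) _ a ⟩
  F zero + (∑ (F ∘ suc) + a)  ≤⟨ +-mono-≤ (off zero (λ ())) (∑-mono-off₁ x (λ z z≢x → off (suc z) (z≢x ∘ suc-injective)) at) ⟩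
  G zero + (∑ (G ∘ suc) + b)  ≡⟨ +-assoc (G zero) _ b ⟨
  G zero + ∑ (G ∘ suc) + b    ∎
  where open ≤-Reasoning

∑-mono-off₂ : ∀ {n} {F G : Fin n → ℕ} x y → x ≢ y → (∀ z → z ≢ x → z ≢ y → F z ≤ G z) →
              F x + F y ≤ G x + G y → ∑ F ≤ ∑ G
∑-mono-off₂ zero zero x≢y off at = ⊥-elim (x≢y refl)
∑-mono-off₂ {F = F} {G} zero (suc y) x≢y off at
  rewrite +-comm (F zero) (∑ (F ∘ suc)) | +-comm (G zero) (∑ (G ∘ suc))
        | +-comm (F zero) (F (suc y)) | +-comm (G zero) (G (suc y)) =
  ∑-mono-off₁ y (λ z z≢y → off (suc z) (λ ()) (z≢y ∘ suc-injective)) at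
∑-mono-off₂ {F = F} {G} (suc x) zero x≢y off at
  rewrite +-comm (F zero) (∑ (F ∘ suc)) | +-comm (G zero) (∑ (G ∘ suc)) =
  ∑-mono-off₁ x (λ z z≢x → off (suc z) (z≢x ∘ suc-injective) (λ ())) at
∑-mono-off₂ (suc x) (suc y) x≢y off at =
  +-mono-≤ (off zero (λ ()) (λ ()))
    (∑-mono-off₂ x y (x≢y ∘ cong suc)
      (λ z z≢x z≢y → off (suc z) (z≢x ∘ suc-injective) (z≢y ∘ suc-injective)) at)

∑-lookup : ∀ {A : Set} (h : A → ℕ) (xs : List A) → ∑ (h ∘ lookup xs) ≡ sum (map h xs)
∑-lookup h xs = cong sum (trans (≡-sym (map-tabulate (lookup xs) h)) (cong (map h) (tabulate-lookup xs)))

-- Taking the sum of the tail as an equation lets one application per block be nested, as in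
-- `∑-kinds`.
sum-map-replicate-++ : ∀ {A : Set} (h : A → ℕ) k a {xs e} → sum (map h xs) ≡ e →
                       sum (map h (replicate k a ++ xs)) ≡ k * h a + e
sum-map-replicate-++ h zero    a eq = eq
sum-map-replicate-++ h (suc k) a eq =
  trans (cong (h a +_) (sum-map-replicate-++ h k a eq)) (≡-sym (+-assoc (h a) (k * h a) _))

-- A move must land on a vertex that already carries a cup, so nothing refills an empty vertex.
emptied-stays-empty : ∀ {G f g} → Reachable G f g → ∀ {t} → f t ≡ 0 → g t ≡ 0
emptied-stays-empty done ft≡0 = ft≡0
emptied-stays-empty {G} {f} (move {g = g} m r) {t} ft≡0 = emptied-stays-empty r gt≡0
  where
  open Move m
  gt≡0 : g t ≡ 0
  gt≡0 with t ≟ x | t ≟ y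
  ... | yes refl | _        = g-x
  ... | no t≢x   | yes refl = ⊥-elim (1+n≰n (subst (1 ≤_) ft≡0 fy≥1))
  ... | no t≢x   | no t≢y   = trans (g-other t t≢x t≢y) ft≡0

-- The four vertex classes and their adjacency.

data Kind : Set where
  core leaf : Bool → Kind

side : Kind → Bool
side (core s) = s
side (leaf s) = s

adjK : Kind → Kind → Bool
adjK (core s) (core s′) = s xor s′
adjK (core s) (leaf s′) = not (s xor s′)
adjK (leaf s) (core s′) = not (s xor s′)
adjK (leaf s) (leaf s′) = false

adjK-sym : ∀ a b → adjK a b ≡ adjK b a
adjK-sym (core s) (core s′) = xor-comm s s′
adjK-sym (core s) (leaf s′) = cong not (xor-comm s s′)
adjK-sym (leaf s) (core s′) = cong not (xor-comm s s′)
adjK-sym (leaf s) (leaf s′) = refl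

adjK-irrefl : ∀ a → adjK a a ≡ false
adjK-irrefl (core false) = refl
adjK-irrefl (core true)  = refl
adjK-irrefl (leaf s)     = refl

-- Intermediate vertices are core vertices, since leaves are adjacent only to these.
ShortPath : Kind → Kind → Set
ShortPath a b =
  adjK a b ≡ true
  ⊎ (∃ λ s → adjK a (core s) ≡ true × adjK (core s) b ≡ true)
  ⊎ (∃₂ λ s s′ → adjK a (core s) ≡ true × adjK (core s) (core s′) ≡ true × adjK (core s′) b ≡ true)

shortPath : ∀ a b → ShortPath a b
shortPath (core false) (core false) = inj₂ (inj₁ (true , refl , refl))
shortPath (core false) (core true)  = inj₁ refl
shortPath (core true)  (core false) = inj₁ refl
shortPath (core true)  (core true)  = inj₂ (inj₁ (false , refl , refl))
shortPath (core false) (leaf false) = inj₁ refl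
shortPath (core false) (leaf true)  = inj₂ (inj₁ (true , refl , refl))
shortPath (core true)  (leaf false) = inj₂ (inj₁ (false , refl , refl))
shortPath (core true)  (leaf true)  = inj₁ refl
shortPath (leaf false) (core false) = inj₁ refl
shortPath (leaf false) (core true)  = inj₂ (inj₁ (false , refl , refl))
shortPath (leaf true)  (core false) = inj₂ (inj₁ (true , refl , refl))
shortPath (leaf true)  (core true)  = inj₁ refl
shortPath (leaf false) (leaf false) = inj₂ (inj₁ (false , refl , refl))
shortPath (leaf false) (leaf true)  = inj₂ (inj₂ (false , true , refl , refl , refl))
shortPath (leaf true)  (leaf false) = inj₂ (inj₂ (true , false , refl , refl , refl))
shortPath (leaf true)  (leaf true)  = inj₂ (inj₁ (true , refl , refl))

-- Weights of stacks and how they change under a move.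

singleWeight : Bool → Kind → ℕ
-- Relative to the neutral 2, a lone cup counts -2 on a core vertex, +1 on a leaf of side `j` and 0
-- on the other leaves: the cups that can give help against those that need it.
singleWeight j (core s) = 0
singleWeight j (leaf s) = if s xor j then 2 else 3

-- The weight of a stack of k cups, shifted by 2 so that it stays in ℕ: the neutral value, that
-- of an empty vertex, is 2.  The leaves on side j are those not adjacent to the target.
weight : Bool → Kind → ℕ → ℕ
weight j a 0 = 2
weight j a 1 = singleWeight j a
weight j a 2 = 1
weight j a 3 = 2
weight j a k@(suc (suc (suc (suc _)))) = 2 + k

weight-one≤3 : ∀ j a → weight j a 1 ≤ 3
weight-one≤3 j (core s) = z≤n
weight-one≤3 j (leaf s) with s xor j
... | true  = n≤1+n 2
... | false = ≤-refl

weight≤2+k : ∀ j a k → weight j a k ≤ 2 + k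
weight≤2+k j a 0 = ≤-refl
weight≤2+k j a 1 = weight-one≤3 j a
weight≤2+k j a 2 = s≤s z≤n
weight≤2+k j a 3 = s≤s (s≤s z≤n)
weight≤2+k j a (suc (suc (suc (suc k)))) = ≤-refl

-- A stack of four or more weighs exactly the upper bound of `weight≤2+k`, so sizes simply add; the
-- leading 2 is the weight of the vacated vertex.
merge-immobile : ∀ j a b r s → 4 ≤ s + r →
                 weight j a r + weight j b s ≤ 2 + weight j b (s + r)
merge-immobile j a b r s 4≤s+r with s + r in eq
merge-immobile j a b r s (s≤s (s≤s (s≤s (s≤s z≤n)))) | suc (suc (suc (suc k))) = begin
  weight j a r + weight j b s  ≤⟨ +-mono-≤ (weight≤2+k j a r) (weight≤2+k j b s) ⟩
  (2 + r) + (2 + s)            ≡⟨ rearrange r s ⟩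
  4 + (s + r)                  ≡⟨ cong (4 +_) eq ⟩
  2 + (2 + (4 + k))            ∎
  where
  open ≤-Reasoning
  rearrange : ∀ r s → (2 + r) + (2 + s) ≡ 4 + (s + r)
  rearrange = solve-∀

-- One of two adjacent vertices is a core vertex, whose single cup weighs 0.
merge-singles : ∀ j a b → adjK a b ≡ true → weight j a 1 + weight j b 1 ≤ 3
merge-singles j (core s) b        _ = weight-one≤3 j b
merge-singles j (leaf s) (core _) _ = ≤-trans (≤-reflexive (+-identityʳ _)) (weight-one≤3 j (leaf s))

-- Below four cups only 1+1, 1+2 and 2+1 remain. Equality can occur, with 0 + 3 = 2 + 1 and 3 + 1 =
-- 2 + 2; this dictates the weights 1 and 2 of stacks of two and three.
weight-merge : ∀ j a b r s → 1 ≤ r → 1 ≤ s → r ≤ 3 → (r ≡ 1 → adjK a b ≡ true) →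
               weight j a r + weight j b s ≤ 2 + weight j b (s + r)
weight-merge j a b r s 1≤r 1≤s r≤3 adj with 4 ≤? s + r
... | yes 4≤s+r = merge-immobile j a b r s 4≤s+r
weight-merge j a b 1 1 _ _ _ adj | no _ = merge-singles j a b (adj refl)
weight-merge j a b 1 2 _ _ _ _   | no _ = +-monoˡ-≤ 1 (weight-one≤3 j a)
weight-merge j a b 2 1 _ _ _ _   | no _ = s≤s (weight-one≤3 j b)
weight-merge j a b 1 (suc (suc (suc s))) _ _ _ _ | no ≰ = ⊥-elim (≰ (s≤s (s≤s (s≤s (m≤n+m 1 s)))))
weight-merge j a b 2 (suc (suc s)) _ _ _ _ | no ≰ = ⊥-elim (≰ (s≤s (s≤s (m≤n+m 2 s))))
weight-merge j a b 3 (suc s) _ _ _ _ | no ≰ = ⊥-elim (≰ (s≤s (m≤n+m 3 s)))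
weight-merge j a b (suc (suc (suc (suc r)))) s _ _ (s≤s (s≤s (s≤s ()))) _ | no _

-- Two kinds of stack exceed the neutral weight. Those of four or more exceed every distance, and a
-- single cup on a leaf of side `j` would need an edge to a vertex on the opposite side.
weight-to-target : ∀ a b r → 1 ≤ r → r ≤ 3 → (r ≡ 1 → adjK a b ≡ true) →
                   weight (not (side b)) a r ≤ 2
weight-to-target (core s)     b            1 _ _ _   = z≤n
weight-to-target (leaf s)     (leaf s′)    1 _ _ adj with () ← adj refl
weight-to-target (leaf false) (core false) 1 _ _ _   = ≤-refl
weight-to-target (leaf true)  (core true)  1 _ _ _   = ≤-refl
weight-to-target (leaf false) (core true)  1 _ _ adj with () ← adj refl
weight-to-target (leaf true)  (core false) 1 _ _ adj with () ← adj refl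
weight-to-target a b 2 _ _ _ = s≤s z≤n
weight-to-target a b 3 _ _ _ = ≤-refl
weight-to-target a b (suc (suc (suc (suc r)))) _ (s≤s (s≤s (s≤s ()))) _

-- The target lies on the side opposite to the leaves of weight 3.
weight-target-initial : ∀ b → weight (not (side b)) b 1 ≤ 2
weight-target-initial (core s)     = z≤n
weight-target-initial (leaf false) = ≤-refl
weight-target-initial (leaf true)  = ≤-refl

-- The blown-up graph: connectivity and diameter.

module BlowUp (c : ℕ) (c≥1 : c ≥ 1) where

  -- One more than the initial deficit of the core: 2c single cups, each 2 below neutral. Each leaf
  -- on side `j` makes up for 1.
  m : ℕ
  m = suc (4 * c)

  kinds : List Kind
  kinds = replicate c (core false) ++ replicate c (core true)
       ++ replicate m (leaf false) ++ replicate m (leaf true) ++ []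

  kind : Fin (length kinds) → Kind
  kind = lookup kinds

  graph : Graph
  graph = record
    { n      = length kinds
    ; adj    = λ x y → adjK (kind x) (kind y)
    ; sym    = λ x y → adjK-sym (kind x) (kind y)
    ; irrefl = λ x → adjK-irrefl (kind x)
    }

  ∑-kinds : ∀ h → ∑ (h ∘ kind) ≡
            c * h (core false) + (c * h (core true) + (m * h (leaf false) + (m * h (leaf true) + 0)))
  ∑-kinds h = trans (∑-lookup h kinds)
    (sum-map-replicate-++ h c (core false) (sum-map-replicate-++ h c (core true)
      (sum-map-replicate-++ h m (leaf false) (sum-map-replicate-++ h m (leaf true) refl))))

  ∈-replicate : ∀ {k} {a : Kind} → 1 ≤ k → a ∈ replicate k a
  ∈-replicate (s≤s _) = here refl

  -- Provides the core vertices that turn a `ShortPath` between kinds into a walk, and the leaf that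
  -- attains the minimum degree.
  kind-surjective : ∀ a → ∃ λ x → kind x ≡ a
  kind-surjective a = index (a∈kinds a) , ≡-sym (lookup-index (a∈kinds a))
    where
    a∈kinds : ∀ a → a ∈ kinds
    a∈kinds (core false) = ∈-++⁺ˡ (∈-replicate c≥1)
    a∈kinds (core true)  = ∈-++⁺ʳ (replicate c _) (∈-++⁺ˡ (∈-replicate c≥1))
    a∈kinds (leaf false) = ∈-++⁺ʳ (replicate c _) (∈-++⁺ʳ (replicate c _) (here refl))
    a∈kinds (leaf true)  = ∈-++⁺ʳ (replicate c _) (∈-++⁺ʳ (replicate c _) (∈-++⁺ʳ (replicate m _) (here refl)))

  edge : ∀ {x y a b} → kind x ≡ a → kind y ≡ b → adjK a b ≡ true → adj graph x y ≡ true
  edge x≡a y≡b ab = trans (cong₂ adjK x≡a y≡b) ab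

  walk≤3 : ∀ x y → ∃ λ k → k ≤ 3 × Walk graph x y k
  walk≤3 x y with shortPath (kind x) (kind y)
  ... | inj₁ xy = 1 , s≤s z≤n , step xy here
  ... | inj₂ (inj₁ (s , xs , sy)) =
    let u , u≡s = kind-surjective (core s)
    in  2 , s≤s (s≤s z≤n) , step (edge refl u≡s xs) (step (edge u≡s refl sy) here)
  ... | inj₂ (inj₂ (s , s′ , xs , ss′ , s′y)) =
    let u , u≡s  = kind-surjective (core s)
        v , v≡s′ = kind-surjective (core s′)
    in  3 , ≤-refl , step (edge refl u≡s xs) (step (edge u≡s v≡s′ ss′) (step (edge v≡s′ refl s′y) here))

  connected : Connected graph
  connected x y with k , _ , w ← walk≤3 x y = k , w

  dist≤3 : ∀ {x y r} → Dist graph x y r → r ≤ 3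
  dist≤3 {x} {y} (_ , minimal) with k , k≤3 , w ← walk≤3 x y =
    ≤-trans (≮⇒≥ (λ k<r → minimal k k<r w)) k≤3

  dist-one : ∀ {x y r} → Dist graph x y r → r ≡ 1 → adjK (kind x) (kind y) ≡ true
  dist-one (step e here , _) refl = e

  -- Degrees.

  degreeK : Kind → ℕ
  degreeK a = c * d (core false) + (c * d (core true) + (m * d (leaf false) + (m * d (leaf true) + 0)))
    where
    d : Kind → ℕ
    d b = if adjK a b then 1 else 0

  degree≡ : ∀ x → degree graph x ≡ degreeK (kind x)
  degree≡ x = trans (cong sum (map-tabulate id (d ∘ kind))) (∑-kinds d)
    where
    d : Kind → ℕ
    d b = if adjK (kind x) b then 1 else 0

  degree-leaf : ∀ s → degreeK (leaf s) ≡ c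
  degree-leaf false = identity c m
    where
    identity : ∀ c m → c * 1 + (c * 0 + (m * 0 + (m * 0 + 0))) ≡ c
    identity = solve-∀
  degree-leaf true = identity c m
    where
    identity : ∀ c m → c * 0 + (c * 1 + (m * 0 + (m * 0 + 0))) ≡ c
    identity = solve-∀

  degree-core : ∀ s → degreeK (core s) ≡ c + m
  degree-core false = identity c m
    where
    identity : ∀ c m → c * 0 + (c * 1 + (m * 1 + (m * 0 + 0))) ≡ c + m
    identity = solve-∀
  degree-core true = identity c m
    where
    identity : ∀ c m → c * 1 + (c * 0 + (m * 0 + (m * 1 + 0))) ≡ c + m
    identity = solve-∀

  degreeK≥c : ∀ a → degreeK a ≥ c
  degreeK≥c (core s) = ≤-trans (m≤m+n c m) (≤-reflexive (≡-sym (degree-core s)))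
  degreeK≥c (leaf s) = ≤-reflexive (≡-sym (degree-leaf s))

  minDegree : MinDegree graph c
  minDegree = (λ x → subst (_≥ c) (≡-sym (degree≡ x)) (degreeK≥c (kind x)))
            , proj₁ ℓ , trans (degree≡ (proj₁ ℓ)) (trans (cong degreeK (proj₂ ℓ)) (degree-leaf false))
    where
    ℓ : ∃ λ x → kind x ≡ leaf false
    ℓ = kind-surjective (leaf false)

  -- The potential argument for a fixed target.

  module Target (t : Fin (length kinds)) where

    j : Bool
    j = not (side (kind t))

    -- The target is neutral whatever it carries, so that the final stack there contributes no large
    -- weight.
    vertexWeight : Fin (length kinds) → ℕ → ℕ
    vertexWeight v k with v ≟ t
    ... | yes _ = 2
    ... | no  _ = weight j (kind v) k

    potential : Config graph → ℕ
    potential f = ∑ (λ v → vertexWeight v (f v))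

    potential-move : ∀ {f g} → Move graph f g → g t ≢ 0 → potential f ≤ potential g
    potential-move {f} {g} mv gt≢0 =
      ∑-mono-off₂ x y x≢y
        (λ z z≢x z≢y → ≤-reflexive (cong (vertexWeight z) (≡-sym (g-other z z≢x z≢y)))) at
      where
      open Move mv
      at : vertexWeight x (f x) + vertexWeight y (f y) ≤ vertexWeight x (g x) + vertexWeight y (g y)
      -- The vacated `x` now weighs 2. If `y` is the target, it weighs 2 before and after, so only
      -- the weight of the moved stack matters.
      at rewrite g-x | g-y with x ≟ t | y ≟ t
      ... | yes refl | _        = ⊥-elim (gt≢0 g-x)
      ... | no _     | yes refl = +-monoˡ-≤ 2 (weight-to-target (kind x) (kind t) (f x) fx≥1 (dist≤3 dist) (dist-one dist))
      ... | no _     | no _     = weight-merge j (kind x) (kind y) (f x) (f y) fx≥1 fy≥1 (dist≤3 dist) (dist-one dist)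

    -- By `emptied-stays-empty`, a target that is nonempty at the end is nonempty after every move,
    -- so `potential-move` applies throughout.
    potential-reachable : ∀ {f g} → Reachable graph f g → g t ≢ 0 → potential f ≤ potential g
    potential-reachable done        gt≢0 = ≤-refl
    potential-reachable (move mv r) ht≢0 =
      ≤-trans (potential-move mv (ht≢0 ∘ emptied-stays-empty r)) (potential-reachable r ht≢0)

    initialWeights : ℕ
    initialWeights = ∑ (λ v → weight j (kind v) 1)

    potential-initial : initialWeights ≤ potential (initial graph)
    potential-initial = ∑-mono pointwise
      where
      pointwise : ∀ v → weight j (kind v) 1 ≤ vertexWeight v 1
      pointwise v with v ≟ t
      ... | yes refl = weight-target-initial (kind t)
      ... | no  _    = ≤-refl

    potential-final : ∀ {g} → AllOn graph t g → potential g ≤ ∑ {length kinds} (λ _ → 2)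
    potential-final {g} (_ , empty) = ∑-mono pointwise
      where
      pointwise : ∀ v → vertexWeight v (g v) ≤ 2
      pointwise v with v ≟ t
      ... | yes _   = ≤-refl
      ... | no  v≢t rewrite empty v v≢t = ≤-refl

    final<initial : ∑ {length kinds} (λ _ → 2) < initialWeights
    -- The value of `j` decides which leaf class has weight 3; either way the excess m - 4c is
    -- exactly 1.
    final<initial rewrite ∑-kinds (λ _ → 2) | ∑-kinds (λ a → weight j a 1) with j
    ... | false = ≤-reflexive (lemma c)
      where
      lemma : ∀ c → 1 + (c * 2 + (c * 2 + ((1 + 4 * c) * 2 + ((1 + 4 * c) * 2 + 0)))) ≡ c * 0 + (c * 0 + ((1 + 4 * c) * 3 + ((1 + 4 * c) * 2 + 0)))
      lemma = solve-∀
    ... | true = ≤-reflexive (lemma c)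
      where
      lemma : ∀ c → 1 + (c * 2 + (c * 2 + ((1 + 4 * c) * 2 + ((1 + 4 * c) * 2 + 0)))) ≡ c * 0 + (c * 0 + ((1 + 4 * c) * 2 + ((1 + 4 * c) * 3 + 0)))
      lemma = solve-∀

    nonempty : length kinds ≢ 0
    nonempty = ≢-nonZero⁻¹ _ ⦃ nonZeroIndex t ⦄

    notStackable : ¬ Stackable graph t
    notStackable (g , r , allOn@(gt≡n , _)) = <⇒≱ final<initial (begin
      initialWeights               ≤⟨ potential-initial ⟩
      potential (initial graph)    ≤⟨ potential-reachable r (λ gt≡0 → nonempty (trans (≡-sym gt≡n) gt≡0)) ⟩
      potential g                  ≤⟨ potential-final allOn ⟩
      ∑ {length kinds} (λ _ → 2)   ∎)
      where open ≤-Reasoning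

theorem4p3 : (c : ℕ) → c ≥ 1 →
    Σ Graph (λ G → Connected G × MinDegree G c × StronglyNonStackable G)
theorem4p3 c c≥1 = graph , connected , minDegree , Target.notStackable
  where open BlowUp c c≥1
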